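{- For every integer $l \ge 1$, the independent domination numbers of the fractal cubic networks satisfy $\gamma_i(FCN(l)) = 4\,\gamma_i(FCN(l-1)) - 2$.
   Context: Fractal cubic network: for an integer $l\ge 0$, $FCN(l)$ is the finite simple graph whose vertices are all binary strings of length $2l+2$, defined recursively as follows. $FCN(0)$ is the 4-cycle with vertices $00, 01, 11, 10$ in this cyclic order. For $l\ge 1$, $FCN(l)$ is obtained from the disjoint union of the four copies $ab\,\Vert\,FCN(l-1)$, $a,b\in\{0,1\}$ (each vertex string of $FCN(l-1)$ is prefixed by $ab$, adjacency inside a copy being that of $FCN(l-1)$), by adding the four edges $\{00w,10w\}$, $\{10w,11w\}$, $\{11w,01w\}$, $\{01w,00w\}$, where $w=10(01)^{l-1}$ is the string $10$ followed by $l-1$ repetitions of $01$. A dominating set of a graph $\Gamma$ is a set $D\subseteq V(\Gamma)$ such that every vertex of $\Gamma$ is in $D$ or adjacent to a vertex of $D$. It is an independent dominating set if moreover the induced subgraph $\Gamma[D]$ has no edges. $\gamma_i(\Gamma)$ is the minimum size of an independent dominating set. -}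

module Defs where

open import Level using (0ℓ)
open import Data.Bool using (Bool; true; false)
import Data.Bool.Properties as Bool
open import Data.Nat using (ℕ; zero; suc; _*_; _≤_; z≤n; s≤s)
open import Data.Vec using (Vec; []; _∷_; concat; replicate; toList; fromList)
import Data.Vec.Properties as Vec
open import Data.List using (List; []; _∷_; length; cartesianProductWith)
open import Data.List.Membership.Propositional using (_∈_; lose; find)
open import Data.List.Membership.Propositional.Properties using (∈-cartesianProductWith⁺)
open import Data.List.Relation.Unary.All as All using (all?)
open import Data.List.Relation.Unary.Any as Any using (here; there; any?)
open import Data.List.Relation.Unary.Unique.Propositional using (Unique; []; _∷_)
open import Data.Product using (∃; _×_; _,_; proj₁; proj₂)
open import Data.Sum using (_⊎_; inj₁; inj₂)
import Data.Sum as Sum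
open import Function using (_∘_)
open import Relation.Binary using (Rel; Symmetric; Irreflexive; Decidable; DecidableEquality)
open import Relation.Binary.Construct.Closure.Symmetric using (SymClosure; fwd; bwd)
import Relation.Binary.Construct.Closure.Symmetric as Sym
open import Relation.Binary.PropositionalEquality using (_≡_; refl; sym; subst)
open import Relation.Nullary using (¬_; Dec; yes; no; contradiction)
open import Relation.Nullary.Decidable using (map′; _×-dec_; _⊎-dec_; ¬?)

record FiniteSimpleGraph : Set₁ where
  infix 4 _~_ _~?_ _≟_
  field
    V          : Set
    _~_        : Rel V 0ℓ
    ~-sym      : Symmetric _~_
    ~-irrefl   : Irreflexive _≡_ _~_
    _~?_       : Decidable _~_
    _≟_        : DecidableEquality V
    vertices   : List V
    ∈-vertices : ∀ v → v ∈ vertices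

module _ (Γ : FiniteSimpleGraph) where
  open FiniteSimpleGraph Γ

  Dominating : List V → Set
  Dominating D = ∀ v → v ∈ D ⊎ (∃ λ u → u ∈ D × v ~ u)

  Independent : List V → Set
  Independent D = ∀ {u v} → u ∈ D → v ∈ D → ¬ (u ~ v)

  -- A set of k vertices is a duplicate-free list of length k.
  HasIndependentDominatingSet : ℕ → Set
  HasIndependentDominatingSet k =
    ∃ λ (D : List V) → Unique D × Dominating D × Independent D × length D ≡ k

IsMinimum : (ℕ → Set) → ℕ → Set
IsMinimum P m = P m × (∀ n → P n → m ≤ n)

minimum : {P : ℕ → Set} → (∀ n → Dec (P n)) → ∀ k → P k → ∃ (IsMinimum P)
minimum P? zero p = zero , p , λ _ _ → z≤n
minimum {P} P? (suc k) p with P? zero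
... | yes p₀ = zero , p₀ , λ _ _ → z≤n
... | no ¬p₀ with minimum (P? ∘ suc) k p
...   | m , pm , m-least = suc m , pm , least
  where
  least : ∀ n → P n → suc m ≤ n
  least zero    p₀ = contradiction p₀ ¬p₀
  least (suc n) pn = s≤s (m-least n pn)

words : {A : Set} → List A → ∀ n → List (Vec A n)
words xs zero    = [] ∷ []
words xs (suc n) = cartesianProductWith _∷_ xs (words xs n)

∈-words : {A : Set} {xs : List A} → (∀ x → x ∈ xs) → ∀ {n} (v : Vec A n) → v ∈ words xs n
∈-words full []      = here refl
∈-words full (x ∷ v) = ∈-cartesianProductWith⁺ _∷_ (full x) (∈-words full v)

module _ (Γ : FiniteSimpleGraph) where
  open FiniteSimpleGraph Γ
  open import Data.List.Membership.DecPropositional _≟_ using (_∈?_)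
  open import Data.List.Relation.Unary.Unique.DecPropositional _≟_ using (unique?)

  neighbour? : ∀ D v → Dec (∃ λ u → u ∈ D × v ~ u)
  neighbour? D v = map′ find (λ (_ , u∈D , v~u) → lose u∈D v~u) (any? (v ~?_) D)

  dominating? : ∀ D → Dec (Dominating Γ D)
  dominating? D =
    map′ (λ h v → All.lookup h (∈-vertices v)) (λ h → All.tabulate λ {v} _ → h v)
      (all? (λ v → (v ∈? D) ⊎-dec neighbour? D v) vertices)

  independent? : ∀ D → Dec (Independent Γ D)
  independent? D =
    map′ (λ h u∈D v∈D → All.lookup (All.lookup h u∈D) v∈D)
         (λ h → All.tabulate λ u∈D → All.tabulate λ v∈D → h u∈D v∈D)
      (all? (λ u → all? (λ v → ¬? (u ~? v)) D) D)

  hasIndependentDominatingSet? : ∀ k → Dec (HasIndependentDominatingSet Γ k)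
  hasIndependentDominatingSet? k = map′ to from (any? good? (words vertices k))
    where
    Good : Vec V k → Set
    Good D = Unique (toList D) × Dominating Γ (toList D) × Independent Γ (toList D)

    good? : ∀ D → Dec (Good D)
    good? D = unique? (toList D) ×-dec dominating? (toList D) ×-dec independent? (toList D)

    to : Any.Any Good (words vertices k) → HasIndependentDominatingSet Γ k
    to h with find h
    ... | D , _ , unq , dom , ind = toList D , unq , dom , (λ {_} {_} → ind) , Vec.length-toList D

    from : HasIndependentDominatingSet Γ k → Any.Any Good (words vertices k)
    from (D , unq , dom , ind , refl) = lose (∈-words ∈-vertices (fromList D))
      (subst (λ E → Unique E × Dominating Γ E × Independent Γ E)
             (sym (Vec.toList∘fromList D)) (unq , dom , λ {_} {_} → ind))

  -- Greedy construction: the resulting independent set dominates all of xs.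
  greedy : ∀ xs → ∃ λ D → Unique D × Independent Γ D ×
           (∀ {v} → v ∈ xs → v ∈ D ⊎ (∃ λ u → u ∈ D × v ~ u))
  greedy [] = [] , [] , (λ ()) , λ ()
  greedy (x ∷ xs) with greedy xs
  ... | D , unq , ind , dom with (x ∈? D) ⊎-dec neighbour? D x
  ...   | yes h = D , unq , (λ {_} {_} → ind) , λ { (here refl) → h ; (there v∈xs) → dom v∈xs }
  ...   | no ¬h = x ∷ D , All.tabulate x≢ ∷ unq , (λ {_} {_} → ind′) , dom′
    where
    x≢ : ∀ {y} → y ∈ D → ¬ (x ≡ y)
    x≢ y∈D refl = ¬h (inj₁ y∈D)

    ind′ : Independent Γ (x ∷ D)
    ind′ (here refl) (here refl) = ~-irrefl refl
    ind′ (here refl) (there v∈D) = λ x~v → ¬h (inj₂ (_ , v∈D , x~v))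
    ind′ (there u∈D) (here refl) = λ u~x → ¬h (inj₂ (_ , u∈D , ~-sym u~x))
    ind′ (there u∈D) (there v∈D) = ind u∈D v∈D

    dom′ : ∀ {v} → v ∈ x ∷ xs → v ∈ x ∷ D ⊎ (∃ λ u → u ∈ x ∷ D × v ~ u)
    dom′ (here v≡x)   = inj₁ (here v≡x)
    dom′ (there v∈xs) = Sum.map there (λ (u , u∈D , v~u) → u , there u∈D , v~u) (dom v∈xs)

  existsIndependentDominatingSet : ∃ (HasIndependentDominatingSet Γ)
  existsIndependentDominatingSet with greedy vertices
  ... | D , unq , ind , dom =
    length D , D , unq , (λ v → dom (∈-vertices v)) , (λ {_} {_} → ind) , refl

  independentDominationNumber : ∃ (IsMinimum (HasIndependentDominatingSet Γ))
  independentDominationNumber =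
    let k , h = existsIndependentDominatingSet
    in minimum hasIndependentDominatingSet? k h

  γᵢ : ℕ
  γᵢ = proj₁ independentDominationNumber

  γᵢ-isMinimum : IsMinimum (HasIndependentDominatingSet Γ) γᵢ
  γᵢ-isMinimum = proj₂ independentDominationNumber

pattern O = false
pattern I = true

-- The 4-cycle 00, 01, 11, 10.  It serves both as FCN(0) and as the pattern in
-- which the four copies are joined: the edges {00w,10w}, {10w,11w}, {11w,01w},
-- {01w,00w} follow the same cycle on the prefixes.
data CycleEdge : Rel (Vec Bool 2) 0ℓ where
  00-01 : CycleEdge (O ∷ O ∷ []) (O ∷ I ∷ [])
  01-11 : CycleEdge (O ∷ I ∷ []) (I ∷ I ∷ [])
  11-10 : CycleEdge (I ∷ I ∷ []) (I ∷ O ∷ [])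
  10-00 : CycleEdge (I ∷ O ∷ []) (O ∷ O ∷ [])

CycleAdj : Rel (Vec Bool 2) 0ℓ
CycleAdj = SymClosure CycleEdge

-- suc l * 2 rather than 2 * l + 2, so that String (suc l) computes to strings
-- with two bits prepended to a String l.
String : ℕ → Set
String l = Vec Bool (suc l * 2)

-- 10(01)ˡ: the vertex of each copy of FCN(l) inside FCN(l+1) that is joined to
-- the other copies.
port : ∀ l → String l
port l = I ∷ O ∷ concat (replicate l (O ∷ I ∷ []))

Adj : ∀ l → Rel (String l) 0ℓ
Adj zero    u           v           = CycleAdj u v
Adj (suc l) (a ∷ b ∷ u) (c ∷ d ∷ v) =
    (ab ≡ cd × Adj l u v)
  ⊎ (CycleAdj ab cd × u ≡ port l × v ≡ port l)
  where
  ab cd : Vec Bool 2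
  ab = a ∷ b ∷ []
  cd = c ∷ d ∷ []

cycleEdge? : Decidable CycleEdge
cycleEdge? (O ∷ O ∷ []) (O ∷ O ∷ []) = no λ ()
cycleEdge? (O ∷ O ∷ []) (O ∷ I ∷ []) = yes 00-01
cycleEdge? (O ∷ O ∷ []) (I ∷ _ ∷ []) = no λ ()
cycleEdge? (O ∷ I ∷ []) (O ∷ _ ∷ []) = no λ ()
cycleEdge? (O ∷ I ∷ []) (I ∷ O ∷ []) = no λ ()
cycleEdge? (O ∷ I ∷ []) (I ∷ I ∷ []) = yes 01-11
cycleEdge? (I ∷ I ∷ []) (O ∷ _ ∷ []) = no λ ()
cycleEdge? (I ∷ I ∷ []) (I ∷ O ∷ []) = yes 11-10
cycleEdge? (I ∷ I ∷ []) (I ∷ I ∷ []) = no λ ()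
cycleEdge? (I ∷ O ∷ []) (O ∷ O ∷ []) = yes 10-00
cycleEdge? (I ∷ O ∷ []) (O ∷ I ∷ []) = no λ ()
cycleEdge? (I ∷ O ∷ []) (I ∷ _ ∷ []) = no λ ()

cycleAdj? : Decidable CycleAdj
cycleAdj? u v = map′ Sum.[ fwd , bwd ] (λ { (fwd e) → inj₁ e ; (bwd e) → inj₂ e })
  (cycleEdge? u v ⊎-dec cycleEdge? v u)

cycleAdj-irrefl : Irreflexive _≡_ CycleAdj
cycleAdj-irrefl refl (fwd ())
cycleAdj-irrefl refl (bwd ())

_≟ᵛ_ : ∀ {n} → DecidableEquality (Vec Bool n)
_≟ᵛ_ = Vec.≡-dec Bool._≟_

adj-sym : ∀ l → Symmetric (Adj l)
adj-sym zero = Sym.symmetric CycleEdge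
adj-sym (suc l) {_ ∷ _ ∷ _} {_ ∷ _ ∷ _} (inj₁ (eq , e)) = inj₁ (sym eq , adj-sym l e)
adj-sym (suc l) {_ ∷ _ ∷ _} {_ ∷ _ ∷ _} (inj₂ (e , u≡ , v≡)) = inj₂ (Sym.symmetric CycleEdge e , v≡ , u≡)

adj-irrefl : ∀ l → Irreflexive _≡_ (Adj l)
adj-irrefl zero = cycleAdj-irrefl
adj-irrefl (suc l) {_ ∷ _ ∷ _} refl (inj₁ (_ , e)) = adj-irrefl l refl e
adj-irrefl (suc l) {_ ∷ _ ∷ _} refl (inj₂ (e , _)) = cycleAdj-irrefl refl e

adj? : ∀ l → Decidable (Adj l)
adj? zero = cycleAdj?
adj? (suc l) (a ∷ b ∷ u) (c ∷ d ∷ v) =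
        (((a ∷ b ∷ []) ≟ᵛ (c ∷ d ∷ [])) ×-dec adj? l u v)
  ⊎-dec (cycleAdj? (a ∷ b ∷ []) (c ∷ d ∷ []) ×-dec ((u ≟ᵛ port l) ×-dec (v ≟ᵛ port l)))

∈-bits : ∀ b → b ∈ O ∷ I ∷ []
∈-bits O = here refl
∈-bits I = there (here refl)

FCN : ℕ → FiniteSimpleGraph
FCN l = record
  { V          = String l
  ; _~_        = Adj l
  ; ~-sym      = adj-sym l
  ; ~-irrefl   = adj-irrefl l
  ; _~?_       = adj? l
  ; _≟_        = _≟ᵛ_
  ; vertices   = words (O ∷ I ∷ []) (suc l * 2)
  ; ∈-vertices = ∈-words ∈-bits
  }

{-# OPTIONS --safe #-}
module Submission where

-- Lower bound: cut an independent dominating set D of FCN(l+1) into its four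
-- slices, one per copy.  Each slice is independent and dominates its copy except
-- possibly the port; if the port is missed, adding it gives an independent
-- dominating set of the copy.  A missed port is dominated by a neighbouring port
-- lying in D, so no three consecutive ports of the 4-cycle are all missed, hence
-- at most two are, and 4 γᵢ(FCN(l)) ≤ |D| + 2.
--
-- Upper bound: let p and q be the port and the corner (01)ˡ⁺¹ of FCN(l).  By
-- induction there is an independent dominating set S containing p and q such that
-- S \ {p} dominates all vertices but p and S \ {q} all vertices but q.  Taking S in
-- the copies 10 and 01 and S \ {p} in the copies 00 and 11, whose ports are
-- dominated from outside, gives such a set of size 4|S| - 2 for FCN(l+1).

open import Defs
open import Data.Bool using (Bool)
open import Data.Nat as ℕ using (ℕ; zero; suc; s≤s; z≤n; _≤_)
import Data.Nat.Properties as ℕ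
open import Data.Nat.Tactic.RingSolver using (solve-∀)
open import Data.Integer using (+_; _*_; _-_)
import Data.Integer as ℤ
import Data.Integer.Properties as ℤ
open import Data.Empty using (⊥; ⊥-elim)
open import Data.Vec using (Vec; []; _∷_; concat; replicate)
import Data.Vec.Properties as Vec
open import Data.List using (List; []; _∷_; _++_; map; length)
open import Data.List.Properties using (length-++; length-map)
open import Data.List.Membership.Propositional using (_∈_; _∉_)
open import Data.List.Membership.Propositional.Properties using (∈-++⁺ˡ; ∈-++⁺ʳ; ∈-++⁻; ∈-map⁺; ∈-map⁻)
open import Data.List.Relation.Binary.Subset.Propositional using (_⊆_)
open import Data.List.Relation.Unary.All as All using ()
open import Data.List.Relation.Unary.Any using (here; there)
open import Data.List.Relation.Unary.Unique.Propositional using (Unique; []; _∷_)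
import Data.List.Relation.Unary.Unique.Propositional.Properties as Unique
open import Data.Product as Product using (∃; _×_; _,_; proj₁; proj₂)
open import Data.Sum using (_⊎_; inj₁; inj₂; [_,_]′)
import Data.Sum as Sum
open import Function using (_∘_)
open import Relation.Binary.Construct.Closure.Symmetric using (fwd; bwd)
open import Relation.Binary.PropositionalEquality
  using (_≡_; _≢_; refl; sym; trans; cong; cong₂; subst; module ≡-Reasoning)
open import Relation.Nullary using (¬_; Dec; yes; no)
open import Relation.Nullary.Decidable using (_⊎-dec_)

-- Splitting and joining lists of bit vectors by the first bit

∉⇒All≢ : ∀ {A : Set} {x : A} {xs} → x ∉ xs → All.All (x ≢_) xs
∉⇒All≢ x∉xs = All.tabulate λ { y∈xs refl → x∉xs y∈xs }

module _ {n : ℕ} where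

  tails : Bool → List (Vec Bool (suc n)) → List (Vec Bool n)
  tails b []            = []
  tails O ((O ∷ u) ∷ D) = u ∷ tails O D
  tails O ((I ∷ u) ∷ D) = tails O D
  tails I ((O ∷ u) ∷ D) = tails I D
  tails I ((I ∷ u) ∷ D) = u ∷ tails I D

  ∈-tails⁺ : ∀ b {u D} → (b ∷ u) ∈ D → u ∈ tails b D
  ∈-tails⁺ O (here refl) = here refl
  ∈-tails⁺ I (here refl) = here refl
  ∈-tails⁺ O {D = (O ∷ _) ∷ _} (there u∈D) = there (∈-tails⁺ O u∈D)
  ∈-tails⁺ O {D = (I ∷ _) ∷ _} (there u∈D) = ∈-tails⁺ O u∈D
  ∈-tails⁺ I {D = (O ∷ _) ∷ _} (there u∈D) = ∈-tails⁺ I u∈D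
  ∈-tails⁺ I {D = (I ∷ _) ∷ _} (there u∈D) = there (∈-tails⁺ I u∈D)

  ∈-tails⁻ : ∀ b {u} D → u ∈ tails b D → (b ∷ u) ∈ D
  ∈-tails⁻ O ((O ∷ _) ∷ D) (here refl)  = here refl
  ∈-tails⁻ O ((O ∷ _) ∷ D) (there u∈D) = there (∈-tails⁻ O D u∈D)
  ∈-tails⁻ O ((I ∷ _) ∷ D) u∈D         = there (∈-tails⁻ O D u∈D)
  ∈-tails⁻ I ((O ∷ _) ∷ D) u∈D         = there (∈-tails⁻ I D u∈D)
  ∈-tails⁻ I ((I ∷ _) ∷ D) (here refl)  = here refl
  ∈-tails⁻ I ((I ∷ _) ∷ D) (there u∈D) = there (∈-tails⁻ I D u∈D)

  tails-unique : ∀ b {D} → Unique D → Unique (tails b D)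
  tails-unique b [] = []
  tails-unique O {(O ∷ _) ∷ D} (v≢ ∷ unq) =
    ∉⇒All≢ (λ u∈ → All.lookup v≢ (∈-tails⁻ O D u∈) refl) ∷ tails-unique O unq
  tails-unique O {(I ∷ _) ∷ D} (_ ∷ unq) = tails-unique O unq
  tails-unique I {(O ∷ _) ∷ D} (_ ∷ unq) = tails-unique I unq
  tails-unique I {(I ∷ _) ∷ D} (v≢ ∷ unq) =
    ∉⇒All≢ (λ u∈ → All.lookup v≢ (∈-tails⁻ I D u∈) refl) ∷ tails-unique I unq

  length-tails : ∀ D → length (tails O D) ℕ.+ length (tails I D) ≡ length D
  length-tails []            = refl
  length-tails ((O ∷ _) ∷ D) = cong suc (length-tails D)
  length-tails ((I ∷ _) ∷ D) = trans (ℕ.+-suc _ _) (cong suc (length-tails D))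

  -- The halves come as a function of the bit, so that two nested uses assemble four copies from a
  -- family indexed by both prefix bits.
  glue : (Bool → List (Vec Bool n)) → List (Vec Bool (suc n))
  glue f = map (O ∷_) (f O) ++ map (I ∷_) (f I)

  ∈-glue⁺ : ∀ f b {u} → u ∈ f b → (b ∷ u) ∈ glue f
  ∈-glue⁺ f O u∈ = ∈-++⁺ˡ (∈-map⁺ (O ∷_) u∈)
  ∈-glue⁺ f I u∈ = ∈-++⁺ʳ (map (O ∷_) (f O)) (∈-map⁺ (I ∷_) u∈)

  ∈-glue⁻ : ∀ f {b u} → (b ∷ u) ∈ glue f → u ∈ f b
  ∈-glue⁻ f v∈ with ∈-++⁻ (map (O ∷_) (f O)) v∈
  ... | inj₁ v∈O with ∈-map⁻ (O ∷_) v∈O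
  ...   | _ , u∈ , refl = u∈
  ∈-glue⁻ f v∈ | inj₂ v∈I with ∈-map⁻ (I ∷_) v∈I
  ...   | _ , u∈ , refl = u∈

  glue-unique : ∀ f → (∀ b → Unique (f b)) → Unique (glue f)
  glue-unique f unq = Unique.++⁺ (Unique.map⁺ Vec.∷-injectiveʳ (unq O))
                                 (Unique.map⁺ Vec.∷-injectiveʳ (unq I)) disjoint
    where
    disjoint : ∀ {v} → ¬ (v ∈ map (O ∷_) (f O) × v ∈ map (I ∷_) (f I))
    disjoint (v∈O , v∈I) with ∈-map⁻ (O ∷_) v∈O | ∈-map⁻ (I ∷_) v∈I
    ... | _ , _ , refl | _ , _ , ()

  length-glue : ∀ f → length (glue f) ≡ length (f O) ℕ.+ length (f I)
  length-glue f = trans (length-++ (map (O ∷_) (f O)))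
    (cong₂ ℕ._+_ (length-map (O ∷_) (f O)) (length-map (I ∷_) (f I)))

module _ (Γ : FiniteSimpleGraph) where
  open FiniteSimpleGraph Γ

  -- `Dominating` at a single vertex, needed for sets that may miss one vertex.
  Covers : List V → V → Set
  Covers D v = v ∈ D ⊎ (∃ λ u → u ∈ D × v ~ u)

  covers-⊆ : ∀ {D E v} → D ⊆ E → Covers D v → Covers E v
  covers-⊆ D⊆E = Sum.map D⊆E (Product.map₂ (Product.map₁ D⊆E))

-- The lower bound

-- The number of vertices to add to a slice: none if its port is covered, the port itself otherwise.
defect : ∀ {P : Set} → Dec P → ℕ
defect (yes _) = 0
defect (no  _) = 1

module _ {P : Vec Bool 2 → Set} (P? : ∀ c → Dec (P c))
         (near : ∀ c → P c ⊎ (∃ λ d → CycleAdj c d × P d)) where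

  not-isolated : ∀ c → ¬ P c → (∀ {d} → CycleAdj c d → ¬ P d) → ⊥
  not-isolated c ¬c ¬d = [ ¬c , (λ (_ , adj , p) → ¬d adj p) ]′ (near c)

  -- Any three vertices of the 4-cycle are a vertex and its two neighbours, so by `near` they cannot
  -- all fail `P`.
  defects≤2 : (defect (P? (O ∷ O ∷ [])) ℕ.+ defect (P? (O ∷ I ∷ [])))
       ℕ.+ (defect (P? (I ∷ O ∷ [])) ℕ.+ defect (P? (I ∷ I ∷ []))) ≤ 2
  defects≤2 with P? (O ∷ O ∷ []) | P? (O ∷ I ∷ []) | P? (I ∷ O ∷ []) | P? (I ∷ I ∷ [])
  -- The first four clauses are the impossible ones, each refuted at the middle vertex of a failing
  -- triple; this first one includes the case of four failures.
  ... | no ¬00 | no ¬01 | no ¬10 | _ =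
    ⊥-elim (not-isolated (O ∷ O ∷ []) ¬00 (λ { (fwd 00-01) → ¬01 ; (bwd 10-00) → ¬10 }))
  ... | no ¬00 | no ¬01 | yes _ | no ¬11 =
    ⊥-elim (not-isolated (O ∷ I ∷ []) ¬01 (λ { (fwd 01-11) → ¬11 ; (bwd 00-01) → ¬00 }))
  ... | no ¬00 | yes _ | no ¬10 | no ¬11 =
    ⊥-elim (not-isolated (I ∷ O ∷ []) ¬10 (λ { (fwd 10-00) → ¬00 ; (bwd 11-10) → ¬11 }))
  ... | yes _ | no ¬01 | no ¬10 | no ¬11 =
    ⊥-elim (not-isolated (I ∷ I ∷ []) ¬11 (λ { (fwd 11-10) → ¬10 ; (bwd 01-11) → ¬01 }))
  ... | no _  | no _  | yes _ | yes _ = s≤s (s≤s z≤n)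
  ... | no _  | yes _ | no _  | yes _ = s≤s (s≤s z≤n)
  ... | no _  | yes _ | yes _ | no _  = s≤s (s≤s z≤n)
  ... | no _  | yes _ | yes _ | yes _ = s≤s z≤n
  ... | yes _ | no _  | no _  | yes _ = s≤s (s≤s z≤n)
  ... | yes _ | no _  | yes _ | no _  = s≤s (s≤s z≤n)
  ... | yes _ | no _  | yes _ | yes _ = s≤s z≤n
  ... | yes _ | yes _ | no _  | no _  = s≤s (s≤s z≤n)
  ... | yes _ | yes _ | no _  | yes _ = s≤s z≤n
  ... | yes _ | yes _ | yes _ | no _  = s≤s z≤n
  ... | yes _ | yes _ | yes _ | yes _ = z≤n

module _ (l : ℕ) {D : List (String (suc l))}
         (unq : Unique D) (dom : Dominating (FCN (suc l)) D) (ind : Independent (FCN (suc l)) D) where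
  open import Data.List.Membership.DecPropositional (_≟ᵛ_ {suc l ℕ.* 2}) using (_∈?_)

  slice : Vec Bool 2 → List (String l)
  slice (a ∷ b ∷ []) = tails b (tails a D)

  Covered : Vec Bool 2 → Set
  Covered c = Covers (FCN l) (slice c) (port l)

  covered? : ∀ c → Dec (Covered c)
  covered? c = (port l ∈? slice c) ⊎-dec neighbour? (FCN l) (slice c) (port l)

  slice-unique : ∀ c → Unique (slice c)
  slice-unique (a ∷ b ∷ []) = tails-unique b (tails-unique a unq)

  ∈-slice⁻ : ∀ a b {u} → u ∈ slice (a ∷ b ∷ []) → (a ∷ b ∷ u) ∈ D
  ∈-slice⁻ a b = ∈-tails⁻ a D ∘ ∈-tails⁻ b (tails a D)

  slice-independent : ∀ c → Independent (FCN l) (slice c)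
  slice-independent (a ∷ b ∷ []) u∈ v∈ u~v =
    ind (∈-slice⁻ a b u∈) (∈-slice⁻ a b v∈) (inj₁ (refl , u~v))

  -- Edges between copies join ports only. So a vertex dominated from outside its copy is the port,
  -- and its dominator is the port of an adjacent copy, which is thereby covered by its own slice.
  slice-covers : ∀ a b u → Covers (FCN l) (slice (a ∷ b ∷ [])) u
    ⊎ (u ≡ port l × (∃ λ d → CycleAdj (a ∷ b ∷ []) d × Covered d))
  slice-covers a b u with dom (a ∷ b ∷ u)
  ... | inj₁ v∈D = inj₁ (inj₁ (∈-tails⁺ b (∈-tails⁺ a v∈D)))
  ... | inj₂ (_ ∷ _ ∷ w , w∈D , inj₁ (refl , u~w)) =
    inj₁ (inj₂ (w , ∈-tails⁺ b (∈-tails⁺ a w∈D) , u~w))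
  ... | inj₂ (a′ ∷ b′ ∷ _ , w∈D , inj₂ (adj , u≡ , refl)) =
    inj₂ (u≡ , a′ ∷ b′ ∷ [] , adj , inj₁ (∈-tails⁺ b′ (∈-tails⁺ a′ w∈D)))

  near-covered : ∀ c → Covered c ⊎ (∃ λ d → CycleAdj c d × Covered d)
  near-covered (a ∷ b ∷ []) = Sum.map₂ proj₂ (slice-covers a b (port l))

  -- At most the port is missed. A missed port is neither in the slice nor adjacent to it, so adding
  -- it preserves uniqueness and independence.
  slice-bound : ∀ c → γᵢ (FCN l) ≤ length (slice c) ℕ.+ defect (covered? c)
  slice-bound c@(a ∷ b ∷ []) with covered? c
  ... | yes cov = subst (γᵢ (FCN l) ≤_) (sym (ℕ.+-identityʳ _))
    (proj₂ (γᵢ-isMinimum (FCN l)) _ (slice c , slice-unique c , dom′ , (λ {_} {_} → slice-independent c) , refl))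
    where
    dom′ : Dominating (FCN l) (slice c)
    dom′ u with slice-covers a b u
    ... | inj₁ cov-u      = cov-u
    ... | inj₂ (refl , _) = cov
  ... | no ¬cov = subst (γᵢ (FCN l) ≤_) (sym (ℕ.+-comm _ 1))
    (proj₂ (γᵢ-isMinimum (FCN l)) _
      (port l ∷ slice c , ∉⇒All≢ (¬cov ∘ inj₁) ∷ slice-unique c , dom′ , (λ {_} {_} → ind′) , refl))
    where
    dom′ : Dominating (FCN l) (port l ∷ slice c)
    dom′ u with slice-covers a b u
    ... | inj₁ cov-u     = covers-⊆ (FCN l) there cov-u
    ... | inj₂ (u≡p , _) = inj₁ (here u≡p)

    ind′ : Independent (FCN l) (port l ∷ slice c)
    ind′ (here refl) (here refl) = adj-irrefl l refl
    ind′ (here refl) (there v∈)  = λ p~v → ¬cov (inj₂ (_ , v∈ , p~v))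
    ind′ (there u∈)  (here refl) = λ u~p → ¬cov (inj₂ (_ , u∈ , adj-sym l u~p))
    ind′ (there u∈)  (there v∈)  = slice-independent c u∈ v∈

  length-slices :
    (length (slice (O ∷ O ∷ [])) ℕ.+ length (slice (O ∷ I ∷ []))) ℕ.+
    (length (slice (I ∷ O ∷ [])) ℕ.+ length (slice (I ∷ I ∷ []))) ≡ length D
  length-slices =
    trans (cong₂ ℕ._+_ (length-tails (tails O D)) (length-tails (tails I D))) (length-tails D)

  lower-bound-length : 4 ℕ.* γᵢ (FCN l) ≤ length D ℕ.+ 2
  lower-bound-length = begin
    4 ℕ.* g                                                              ≡⟨ four g ⟩
    (g ℕ.+ g) ℕ.+ (g ℕ.+ g)
      ≤⟨ ℕ.+-mono-≤ (ℕ.+-mono-≤ (slice-bound (O ∷ O ∷ [])) (slice-bound (O ∷ I ∷ [])))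
                   (ℕ.+-mono-≤ (slice-bound (I ∷ O ∷ [])) (slice-bound (I ∷ I ∷ []))) ⟩
    ((n (O ∷ O ∷ []) ℕ.+ e (O ∷ O ∷ [])) ℕ.+ (n (O ∷ I ∷ []) ℕ.+ e (O ∷ I ∷ []))) ℕ.+
    ((n (I ∷ O ∷ []) ℕ.+ e (I ∷ O ∷ [])) ℕ.+ (n (I ∷ I ∷ []) ℕ.+ e (I ∷ I ∷ [])))
      -- Lengths are separated from defects: the former add up to `length D`, the latter to at most
      -- 2.
      ≡⟨ shuffle (n (O ∷ O ∷ [])) _ (n (O ∷ I ∷ [])) _ (n (I ∷ O ∷ [])) _ (n (I ∷ I ∷ [])) _ ⟩
    ((n (O ∷ O ∷ []) ℕ.+ n (O ∷ I ∷ [])) ℕ.+ (n (I ∷ O ∷ []) ℕ.+ n (I ∷ I ∷ []))) ℕ.+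
    ((e (O ∷ O ∷ []) ℕ.+ e (O ∷ I ∷ [])) ℕ.+ (e (I ∷ O ∷ []) ℕ.+ e (I ∷ I ∷ [])))
      ≤⟨ ℕ.+-mono-≤ (ℕ.≤-reflexive length-slices) (defects≤2 covered? near-covered) ⟩
    length D ℕ.+ 2                                                       ∎
    where
    open ℕ.≤-Reasoning
    g : ℕ
    g = γᵢ (FCN l)
    n e : Vec Bool 2 → ℕ
    n c = length (slice c)
    e c = defect (covered? c)
    four : ∀ x → 4 ℕ.* x ≡ (x ℕ.+ x) ℕ.+ (x ℕ.+ x)
    four = solve-∀
    shuffle : ∀ a b c d a′ b′ c′ d′ →
      ((a ℕ.+ b) ℕ.+ (c ℕ.+ d)) ℕ.+ ((a′ ℕ.+ b′) ℕ.+ (c′ ℕ.+ d′)) ≡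
      ((a ℕ.+ c) ℕ.+ (a′ ℕ.+ c′)) ℕ.+ ((b ℕ.+ d) ℕ.+ (b′ ℕ.+ d′))
    shuffle = solve-∀

γᵢ-lower : ∀ l → 4 ℕ.* γᵢ (FCN l) ≤ γᵢ (FCN (suc l)) ℕ.+ 2
γᵢ-lower l = bound (proj₁ (γᵢ-isMinimum (FCN (suc l))))
  where
  -- A variable `k` in place of `γᵢ` lets `length D ≡ k` be matched with `refl`.
  bound : ∀ {k} → HasIndependentDominatingSet (FCN (suc l)) k → 4 ℕ.* γᵢ (FCN l) ≤ k ℕ.+ 2
  bound (D , unq , dom , ind , refl) = lower-bound-length l unq dom ind

-- The upper bound

-- Inside the copies 10 and 01 of FCN(l), corner l becomes the port and the corner
-- of FCN(l+1) respectively, so an inductive construction has to control both vertices.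
corner : ∀ l → String l
corner l = concat (replicate (suc l) (O ∷ I ∷ []))

interior : ∀ l → List (String l)
-- The share of each copy, apart from the port and corner of `FCN (suc l)`. Copies 00 and 11 lose
-- their port. Copies 01 and 10 lose their corner, which is the corner or port of `FCN (suc l)` and
-- is listed separately in `ids`.
block : ∀ l → Bool → Bool → List (String l)

interior zero    = []
interior (suc l) = glue λ a → glue (block l a)

block l O O = corner l ∷ interior l
block l O I = port l ∷ interior l
block l I O = port l ∷ interior l
block l I I = corner l ∷ interior l

-- The set S of the construction. With port and corner in front, S without either of them is again a
-- cons onto `interior l`.
ids : ∀ l → List (String l)
ids l = port l ∷ corner l ∷ interior l

∈-interior⁺ : ∀ l a b {u} → u ∈ block l a b → (a ∷ b ∷ u) ∈ interior (suc l)
∈-interior⁺ l a b = ∈-glue⁺ (λ a → glue (block l a)) a ∘ ∈-glue⁺ (block l a) b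

∈-interior⁻ : ∀ l a b {u} → (a ∷ b ∷ u) ∈ interior (suc l) → u ∈ block l a b
∈-interior⁻ l a b = ∈-glue⁻ (block l a) ∘ ∈-glue⁻ (λ a → glue (block l a))

ids-unique : ∀ l → Unique (ids l)
ids-unique zero = ((λ ()) All.∷ All.[]) ∷ All.[] ∷ []
ids-unique (suc l) with ids-unique l
... | (p≢q All.∷ p≢) ∷ q≢ ∷ unq =
  -- Within copies 10 and 01 the new port and corner both read `corner l`, which those blocks omit.
  ((λ ()) All.∷ ∉⇒All≢ (q∉ ∘ ∈-interior⁻ l I O)) ∷ ∉⇒All≢ (q∉ ∘ ∈-interior⁻ l O I) ∷
  glue-unique _ (λ a → glue-unique _ (block-unique a))
  where
  q∉ : corner l ∉ port l ∷ interior l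
  q∉ (here q≡p)  = p≢q (sym q≡p)
  q∉ (there q∈) = All.lookup q≢ q∈ refl

  block-unique : ∀ a b → Unique (block l a b)
  block-unique O O = q≢ ∷ unq
  block-unique O I = p≢ ∷ unq
  block-unique I O = p≢ ∷ unq
  block-unique I I = q≢ ∷ unq

-- The second component records that S contains the ports of copies 01 and 10 only; this excludes
-- edges of S between copies.
∈-ids⁻ : ∀ l a b {u} → (a ∷ b ∷ u) ∈ ids (suc l) → u ∈ ids l × (u ≡ port l → a ≢ b)
∈-ids⁻ l _ _ (here refl)         = there (here refl) , λ _ ()
∈-ids⁻ l _ _ (there (here refl)) = there (here refl) , λ _ ()
∈-ids⁻ l a b (there (there v∈)) = in-block a b (∈-interior⁻ l a b v∈)
  where
  p∉ : port l ∉ corner l ∷ interior l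
  p∉ p∈ with ids-unique l
  ... | p≢ ∷ _ = All.lookup p≢ p∈ refl

  p∷R⊆ : port l ∷ interior l ⊆ ids l
  p∷R⊆ (here eq)  = here eq
  p∷R⊆ (there u∈) = there (there u∈)

  in-block : ∀ a b {u} → u ∈ block l a b → u ∈ ids l × (u ≡ port l → a ≢ b)
  in-block O O u∈ = there u∈ , λ { refl _ → p∉ u∈ }
  in-block O I u∈ = p∷R⊆ u∈ , λ _ ()
  in-block I O u∈ = p∷R⊆ u∈ , λ _ ()
  in-block I I u∈ = there u∈ , λ { refl _ → p∉ u∈ }

-- The 4-cycle is bipartite with classes {00, 11} and {01, 10}.
cycleAdj-diagonal : ∀ {a b c d} → CycleAdj (a ∷ b ∷ []) (c ∷ d ∷ []) → a ≡ b ⊎ c ≡ d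
cycleAdj-diagonal (fwd 00-01) = inj₁ refl
cycleAdj-diagonal (fwd 01-11) = inj₂ refl
cycleAdj-diagonal (fwd 11-10) = inj₁ refl
cycleAdj-diagonal (fwd 10-00) = inj₂ refl
cycleAdj-diagonal (bwd 00-01) = inj₂ refl
cycleAdj-diagonal (bwd 01-11) = inj₁ refl
cycleAdj-diagonal (bwd 11-10) = inj₂ refl
cycleAdj-diagonal (bwd 10-00) = inj₁ refl

-- An edge inside a copy contradicts induction. An edge between copies has an end in copy 00 or 11,
-- whose port is not in S.
ids-independent : ∀ l → Independent (FCN l) (ids l)
ids-independent zero (here refl)         (here refl)         = adj-irrefl 0 refl
ids-independent zero (here refl)         (there (here refl)) = λ { (fwd ()) ; (bwd ()) }
ids-independent zero (there (here refl)) (here refl)         = λ { (fwd ()) ; (bwd ()) }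
ids-independent zero (there (here refl)) (there (here refl)) = adj-irrefl 0 refl
ids-independent (suc l) {a ∷ b ∷ u} {c ∷ d ∷ v} u∈ v∈ (inj₁ (_ , u~v)) =
  ids-independent l (proj₁ (∈-ids⁻ l a b u∈)) (proj₁ (∈-ids⁻ l c d v∈)) u~v
ids-independent (suc l) {a ∷ b ∷ u} {c ∷ d ∷ v} u∈ v∈ (inj₂ (adj , u≡p , v≡p)) =
  [ proj₂ (∈-ids⁻ l a b u∈) u≡p , proj₂ (∈-ids⁻ l c d v∈) v≡p ]′ (cycleAdj-diagonal adj)

covers-lift : ∀ l a b {D E u} → (∀ {x} → x ∈ D → (a ∷ b ∷ x) ∈ E) →
  Covers (FCN l) D u → Covers (FCN (suc l)) E (a ∷ b ∷ u)
covers-lift l a b emb (inj₁ u∈)              = inj₁ (emb u∈)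
covers-lift l a b emb (inj₂ (x , x∈ , u~x)) = inj₂ (a ∷ b ∷ x , emb x∈ , inj₁ (refl , u~x))

-- Proved together with `without-corner`: the corner of a copy can become the port of the next
-- level, so each level needs both properties of the previous one.
without-port : ∀ l v → v ≡ port l ⊎ Covers (FCN l) (corner l ∷ interior l) v
without-corner : ∀ l v → v ≡ corner l ⊎ Covers (FCN l) (port l ∷ interior l) v

ids-dominating : ∀ l → Dominating (FCN l) (ids l)
ids-dominating l v = [ inj₁ ∘ here , covers-⊆ (FCN l) there ]′ (without-port l v)

without-port zero (O ∷ O ∷ []) = inj₂ (inj₂ (_ , here refl , fwd 00-01))
without-port zero (O ∷ I ∷ []) = inj₂ (inj₁ (here refl))
without-port zero (I ∷ O ∷ []) = inj₁ refl
without-port zero (I ∷ I ∷ []) = inj₂ (inj₂ (_ , here refl , bwd 01-11))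
without-port (suc l) (O ∷ O ∷ u) with without-port l u
-- The port removed from copy 00 is dominated by the port of copy 01, which is kept.
... | inj₁ u≡p = inj₂ (inj₂ (_ , there (∈-interior⁺ l O I (here refl)) , inj₂ (fwd 00-01 , u≡p , refl)))
... | inj₂ cov = inj₂ (covers-lift l O O (there ∘ ∈-interior⁺ l O O) cov)
without-port (suc l) (I ∷ I ∷ u) with without-port l u
... | inj₁ u≡p = inj₂ (inj₂ (_ , there (∈-interior⁺ l O I (here refl)) , inj₂ (bwd 01-11 , u≡p , refl)))
... | inj₂ cov = inj₂ (covers-lift l I I (there ∘ ∈-interior⁺ l I I) cov)
-- Dropping the port of `FCN (suc l)` takes the corner out of copy 10.
without-port (suc l) (I ∷ O ∷ u) =
  Sum.map (cong (λ w → I ∷ O ∷ w)) (covers-lift l I O (there ∘ ∈-interior⁺ l I O)) (without-corner l u)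
-- Copy 01 still holds all of S: its block together with `corner (suc l)`.
without-port (suc l) (O ∷ I ∷ u) = inj₂ (covers-lift l O I emb (ids-dominating l u))
  where
  emb : ∀ {x} → x ∈ ids l → (O ∷ I ∷ x) ∈ corner (suc l) ∷ interior (suc l)
  emb (here refl)         = there (∈-interior⁺ l O I (here refl))
  emb (there (here refl)) = here refl
  emb (there (there x∈)) = there (∈-interior⁺ l O I (there x∈))

without-corner zero (O ∷ O ∷ []) = inj₂ (inj₂ (_ , here refl , bwd 10-00))
without-corner zero (O ∷ I ∷ []) = inj₁ refl
without-corner zero (I ∷ O ∷ []) = inj₂ (inj₁ (here refl))
without-corner zero (I ∷ I ∷ []) = inj₂ (inj₂ (_ , here refl , fwd 11-10))
without-corner (suc l) (O ∷ O ∷ u) with without-port l u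
... | inj₁ u≡p = inj₂ (inj₂ (_ , there (∈-interior⁺ l I O (here refl)) , inj₂ (bwd 10-00 , u≡p , refl)))
... | inj₂ cov = inj₂ (covers-lift l O O (there ∘ ∈-interior⁺ l O O) cov)
without-corner (suc l) (I ∷ I ∷ u) with without-port l u
... | inj₁ u≡p = inj₂ (inj₂ (_ , there (∈-interior⁺ l I O (here refl)) , inj₂ (fwd 11-10 , u≡p , refl)))
... | inj₂ cov = inj₂ (covers-lift l I I (there ∘ ∈-interior⁺ l I I) cov)
without-corner (suc l) (O ∷ I ∷ u) =
  Sum.map (cong (λ w → O ∷ I ∷ w)) (covers-lift l O I (there ∘ ∈-interior⁺ l O I)) (without-corner l u)
without-corner (suc l) (I ∷ O ∷ u) = inj₂ (covers-lift l I O emb (ids-dominating l u))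
  where
  emb : ∀ {x} → x ∈ ids l → (I ∷ O ∷ x) ∈ port (suc l) ∷ interior (suc l)
  emb (here refl)         = there (∈-interior⁺ l I O (here refl))
  emb (there (here refl)) = here refl
  emb (there (there x∈)) = there (∈-interior⁺ l I O (there x∈))

-- Four blocks of one vertex less than `ids l`, plus the new port and corner.
length-ids : ∀ l → length (ids (suc l)) ℕ.+ 2 ≡ 4 ℕ.* length (ids l)
length-ids l = begin
  2 ℕ.+ length (interior (suc l)) ℕ.+ 2
    ≡⟨ cong (λ n → 2 ℕ.+ n ℕ.+ 2) (trans (length-glue (λ a → glue (block l a)))
         (cong₂ ℕ._+_ (length-glue (block l O)) (length-glue (block l I)))) ⟩
  2 ℕ.+ ((suc r ℕ.+ suc r) ℕ.+ (suc r ℕ.+ suc r)) ℕ.+ 2 ≡⟨ count r ⟩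
  4 ℕ.* (2 ℕ.+ r)                                       ∎
  where
  open ≡-Reasoning
  r : ℕ
  r = length (interior l)
  count : ∀ r → 2 ℕ.+ ((suc r ℕ.+ suc r) ℕ.+ (suc r ℕ.+ suc r)) ℕ.+ 2 ≡ 4 ℕ.* (2 ℕ.+ r)
  count = solve-∀

-- Exact value and recurrence

γᵢ≤length-ids : ∀ l → γᵢ (FCN l) ≤ length (ids l)
γᵢ≤length-ids l = proj₂ (γᵢ-isMinimum (FCN l)) _
  (ids l , ids-unique l , ids-dominating l , (λ {_} {_} → ids-independent l) , refl)

γᵢ≡length-ids : ∀ l → γᵢ (FCN l) ≡ length (ids l)
-- The minimum search on the 4-cycle evaluates to 2.
γᵢ≡length-ids zero    = refl
γᵢ≡length-ids (suc l) = ℕ.≤-antisym (γᵢ≤length-ids (suc l)) (ℕ.+-cancelʳ-≤ 2 _ _ (begin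
  length (ids (suc l)) ℕ.+ 2 ≡⟨ length-ids l ⟩
  4 ℕ.* length (ids l)       ≡⟨ cong (4 ℕ.*_) (γᵢ≡length-ids l) ⟨
  4 ℕ.* γᵢ (FCN l)           ≤⟨ γᵢ-lower l ⟩
  γᵢ (FCN (suc l)) ℕ.+ 2     ∎))
  where open ℕ.≤-Reasoning

-- Subtraction is taken in the integers, so it is not truncated; the counting itself stays additive
-- in the naturals.
ℕ⇒ℤ : ∀ m n → m ℕ.+ 2 ≡ 4 ℕ.* n → + m ≡ + 4 * + n - + 2
ℕ⇒ℤ m n eq = begin
  + m                       ≡⟨ ℤ.+-identityʳ (+ m) ⟨
  -- `+ 2 - + 2` computes to `+ 0`, and `+ m ℤ.+ + 2` to `+ (m ℕ.+ 2)`.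
  + m ℤ.+ (+ 2 - + 2)       ≡⟨ ℤ.+-assoc (+ m) (+ 2) (ℤ.- + 2) ⟨
  + (m ℕ.+ 2) - + 2         ≡⟨ cong (λ k → + k - + 2) eq ⟩
  + (4 ℕ.* n) - + 2         ≡⟨ cong (_- + 2) (ℤ.pos-* 4 n) ⟩
  + 4 * + n - + 2           ∎
  where open ≡-Reasoning

corollary1 : ∀ (l : ℕ) → + γᵢ (FCN (suc l)) ≡ + 4 * + γᵢ (FCN l) - + 2
corollary1 l = ℕ⇒ℤ (γᵢ (FCN (suc l))) (γᵢ (FCN l)) (begin
  γᵢ (FCN (suc l)) ℕ.+ 2     ≡⟨ cong (ℕ._+ 2) (γᵢ≡length-ids (suc l)) ⟩
  length (ids (suc l)) ℕ.+ 2 ≡⟨ length-ids l ⟩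
  4 ℕ.* length (ids l)       ≡⟨ cong (4 ℕ.*_) (γᵢ≡length-ids l) ⟨
  4 ℕ.* γᵢ (FCN l)           ∎)
  where open ≡-Reasoning
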